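{- Let $G$ be a connected graph, let $\mathcal{T}$ be a set of $t$ pairwise edge-disjoint triangles of $G$, let $n_2'$ be the number of vertices of $G$ of degree at least $2$ that do not lie on any triangle of $\mathcal{T}$, and let $c$ be the number of connected components of the subgraph $G[E(\mathcal{T})]$ formed by the edges of the triangles in $\mathcal{T}$. Then $rc(L(G))\leq t+n_2'+c$. Moreover, the bound is sharp: there exist a connected graph $G$ and such a set $\mathcal{T}$ for which equality holds.
   Context: All graphs are simple, finite and undirected. $L(G)$ is the line graph of $G$. For an edge-colouring of a graph (adjacent edges may receive the same colour), a path is rainbow if no two of its edges have the same colour; the graph is rainbow connected if every two vertices are joined by a rainbow path. The rainbow connection number $rc(H)$ of a connected graph $H$ is the smallest number of colours in an edge-colouring making $H$ rainbow connected. -}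

module Defs where

open import Data.Fin using (Fin; _<_)
open import Data.Fin.Properties using (_≟_; _<?_; any?)
open import Data.List using (List; []; _∷_; length; filter; lookup; allFin; cartesianProduct)
open import Data.List.Membership.Propositional using (_∈_)
open import Data.List.Relation.Unary.Any as Any using (Any)
open import Data.List.Relation.Unary.Unique.Propositional using (Unique)
open import Data.Nat using (ℕ; _≤_; _≤?_)
open import Data.Product using (Σ; Σ-syntax; ∃-syntax; _×_; _,_; proj₁)
open import Function.Bundles using (Bijection)
open import Level using (0ℓ)
open import Relation.Binary using (Rel; Setoid; Decidable; Irreflexive; Symmetric; IsEquivalence)
open import Relation.Binary.Construct.Closure.ReflexiveTransitive using (Star; ε; _◅_; _◅◅_; reverse)
import Relation.Binary.Construct.On as On
open import Relation.Binary.PropositionalEquality using (_≡_; _≢_; ≢-sym; setoid)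
open import Relation.Nullary using (¬_; Dec)
open import Relation.Nullary.Decidable using (_×-dec_; ¬?)

import Data.List.Membership.DecPropositional as DecMembership

private
  module _ {n : ℕ} where
    open DecMembership (_≟_ {n}) public using (_∈?_)

-- A finite simple undirected graph with vertex set Fin n.
record Graph (n : ℕ) : Set₁ where
  field
    Adj    : Rel (Fin n) 0ℓ
    adj?   : Decidable Adj
    sym    : Symmetric Adj
    irrefl : Irreflexive _≡_ Adj

open Graph public

Walk : ∀ {n} → Graph n → Rel (Fin n) 0ℓ
Walk G = Star (Adj G)

vertices : ∀ {n} {R : Rel (Fin n) 0ℓ} {u v} → Star R u v → List (Fin n)
vertices {u = u} ε       = u ∷ []
vertices {u = u} (_ ◅ w) = u ∷ vertices w

IsPath : ∀ {n} {R : Rel (Fin n) 0ℓ} {u v} → Star R u v → Set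
IsPath w = Unique (vertices w)

-- A connected graph has at least one vertex.
Connected : ∀ {n} → Graph n → Set
Connected {n} G = Fin n × (∀ u v → Walk G u v)

degree : ∀ {n} → Graph n → Fin n → ℕ
degree {n} G v = length (filter (adj? G v) (allFin n))

-- Each edge {u , v} is listed exactly once, as the pair with u < v.
edges : ∀ {n} → Graph n → List (Fin n × Fin n)
edges {n} G =
  filter (λ { (u , v) → (u <? v) ×-dec adj? G u v })
         (cartesianProduct (allFin n) (allFin n))

endpoints : ∀ {n} → Fin n × Fin n → List (Fin n)
endpoints (u , v) = u ∷ v ∷ []

-- The vertices of L(G) are the positions in the duplicate-free list edges G.
lineGraph : ∀ {n} (G : Graph n) → Graph (length (edges G))
lineGraph {n} G = record
  { Adj    = λ i j → i ≢ j × ∃[ w ] (w ∈ ends i × w ∈ ends j)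
  ; adj?   = λ i j → ¬? (i ≟ j) ×-dec any? (λ w → (w ∈? ends i) ×-dec (w ∈? ends j))
  ; sym    = λ { (i≢j , w , p , q) → ≢-sym i≢j , w , q , p }
  ; irrefl = λ { i≡j (i≢j , _) → i≢j i≡j }
  }
  where
  ends : Fin (length (edges G)) → List (Fin n)
  ends i = endpoints (lookup (edges G) i)

-- Requiring symmetry for all proofs of adjacency also makes the colour of an
-- edge independent of the chosen proof.
record EdgeColouring {n : ℕ} (H : Graph n) (k : ℕ) : Set where
  field
    colour     : ∀ {u v} → Adj H u v → Fin k
    colour-sym : ∀ {u v} (p : Adj H u v) (q : Adj H v u) → colour p ≡ colour q

open EdgeColouring public

colours : ∀ {n k} {H : Graph n} (χ : EdgeColouring H k) {u v} → Walk H u v → List (Fin k)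
colours χ ε       = []
colours χ (e ◅ w) = colour χ e ∷ colours χ w

RainbowPath : ∀ {n k} {H : Graph n} → EdgeColouring H k → Rel (Fin n) 0ℓ
RainbowPath {H = H} χ u v = Σ[ w ∈ Walk H u v ] (IsPath w × Unique (colours χ w))

RainbowConnected : ∀ {n k} {H : Graph n} → EdgeColouring H k → Set
RainbowConnected χ = ∀ u v → RainbowPath χ u v

RainbowColourable : ∀ {n} → Graph n → ℕ → Set
RainbowColourable H k = Σ[ χ ∈ EdgeColouring H k ] RainbowConnected χ

-- rc(H) = r.
IsRainbowConnectionNumber : ∀ {n} → Graph n → ℕ → Set
IsRainbowConnectionNumber H r =
  RainbowColourable H r × (∀ k → RainbowColourable H k → r ≤ k)

record Triangle {n : ℕ} (G : Graph n) : Set where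
  field
    a b c : Fin n
    ab    : Adj G a b
    bc    : Adj G b c
    ac    : Adj G a c

corners : ∀ {n} {G : Graph n} → Triangle G → List (Fin n)
corners Δ = a ∷ b ∷ c ∷ []
  where open Triangle Δ

EdgeOf : ∀ {n} {G : Graph n} → Triangle G → Rel (Fin n) 0ℓ
EdgeOf Δ u v = u ∈ corners Δ × v ∈ corners Δ × u ≢ v

-- Irreflexive, and independent of the order of the corners: a list whose
-- entries are pairwise EdgeDisjoint is a set of distinct triangles whose
-- cardinality is the length of the list.
EdgeDisjoint : ∀ {n} {G : Graph n} → Rel (Triangle G) 0ℓ
EdgeDisjoint Δ Δ′ = ∀ u v → EdgeOf Δ u v → ¬ EdgeOf Δ′ u v

OnTriangle : ∀ {n} {G : Graph n} → List (Triangle G) → Fin n → Set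
OnTriangle 𝒯 v = Any (λ Δ → v ∈ corners Δ) 𝒯

onTriangle? : ∀ {n} {G : Graph n} (𝒯 : List (Triangle G)) (v : Fin n) → Dec (OnTriangle 𝒯 v)
onTriangle? 𝒯 v = Any.any? (λ Δ → v ∈? corners Δ) 𝒯

n₂′ : ∀ {n} (G : Graph n) → List (Triangle G) → ℕ
n₂′ {n} G 𝒯 =
  length (filter (λ v → (2 ≤? degree G v) ×-dec ¬? (onTriangle? 𝒯 v)) (allFin n))

TriangleEdge : ∀ {n} {G : Graph n} → List (Triangle G) → Rel (Fin n) 0ℓ
TriangleEdge 𝒯 u v = Any (λ Δ → EdgeOf Δ u v) 𝒯

-- The vertices of G[E(𝒯)], two of them being equal when they are joined by a
-- walk in G[E(𝒯)]; the classes of this setoid are the connected components.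
Components : ∀ {n} {G : Graph n} → List (Triangle G) → Setoid 0ℓ 0ℓ
Components 𝒯 = record
  { Carrier       = Σ _ (OnTriangle 𝒯)
  ; _≈_           = λ x y → Star (TriangleEdge 𝒯) (proj₁ x) (proj₁ y)
  ; isEquivalence = On.isEquivalence proj₁ joined
  }
  where
  joined : IsEquivalence (Star (TriangleEdge 𝒯))
  joined = record
    { refl  = ε
    ; sym   = reverse (Any.map (λ { (p , q , u≢v) → q , p , ≢-sym u≢v }))
    ; trans = _◅◅_
    }

-- G[E(𝒯)] has exactly c connected components.
HasComponents : ∀ {n} {G : Graph n} → List (Triangle G) → ℕ → Set
HasComponents 𝒯 c = Bijection (Components 𝒯) (setoid (Fin c))

{-# OPTIONS --safe #-}
module Submission where

-- The edges of L(G) split into the cliques ("stars") K(v) of edges of G at v.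
-- Grow a set S of vertices of G and a colouring of the stars centred in S such
-- that any two edges of G meeting S are joined by a rainbow walk inside these
-- stars. A neighbour w of S can be added at the cost of one new colour, used on
-- all of K(w). If a triangle p x y meets S only in p, both x and y can be added
-- at the cost of a single new colour. A new colour is thus needed at most once
-- for each component of G[E(𝒯)], when S first reaches it, once for each triangle
-- of 𝒯, and once for each vertex of degree at least 2 outside the triangles; the
-- remaining stars have no edges. Equality holds for a triangle with pendant edges
-- at two of its corners, because these two edges are not adjacent in L(G).

open import Defs
open import Data.Fin as Fin using (Fin; zero; suc; #_; toℕ; fromℕ<; combine; remQuot; finToFun; funToFin)
open import Data.Fin.Properties as Fin
  using (any?; all?; injective⇒≤; remQuot-combine; finToFun-funToFin; fromℕ<-cong; toℕ-fromℕ<)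
open import Data.List using (List; []; _∷_; _++_; _ʳ++_; map; length; lookup; filter; allFin;
  cartesianProduct; reverse)
open import Data.List.Membership.Propositional using (_∈_; _∉_; find)
open import Data.List.Membership.Propositional.Properties
open import Data.List.Properties using (length-++; length-map; length-tabulate; length-filter)
open import Data.List.Relation.Binary.Permutation.Propositional using (↭-sym; ↭⇒↭ₛ)
open import Data.List.Relation.Binary.Permutation.Propositional.Properties using (↭-reverse)
import Data.List.Relation.Binary.Permutation.Setoid.Properties as Permutation
open import Data.List.Relation.Binary.Sublist.Propositional using (_⊆_; []; _∷_; _∷ʳ_; ⊆-refl; ⊆-trans)
open import Data.List.Relation.Binary.Sublist.Propositional.Properties using (All-resp-⊆)
open import Data.List.Relation.Unary.All as All using (All; []; _∷_)
open import Data.List.Relation.Unary.All.Properties using (¬Any⇒All¬)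
open import Data.List.Relation.Unary.AllPairs using (AllPairs; []; _∷_)
open import Data.List.Relation.Unary.Any as Any using (here; there)
open import Data.List.Relation.Unary.Any.Properties using (lookup-index)
open import Data.List.Relation.Unary.Unique.Propositional using (Unique)
import Data.List.Relation.Unary.Unique.Propositional.Properties as Unique
open import Data.Nat as ℕ using (ℕ; zero; suc; _+_; _*_; _^_; _≤_; _<_; z≤n; s≤s)
import Data.Nat.Properties as ℕ
open import Data.Product using (Σ-syntax; ∃-syntax; _×_; _,_; proj₁; proj₂)
open import Data.Product.Properties using (≡-dec)
open import Data.Sum as Sum using (_⊎_; inj₁; inj₂; [_,_]′)
open import Function using (_∘_; id)
open import Function.Bundles using (Bijection)
open import Relation.Binary using (Setoid; tri<; tri≈; tri>)
open import Relation.Binary.Construct.Closure.ReflexiveTransitive as Star using (Star; ε; _◅_; _◅◅_)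
open import Relation.Binary.PropositionalEquality
  using (_≡_; _≢_; refl; trans; cong; cong₂; subst; setoid) renaming (sym to ≡-sym)
open import Relation.Nullary using (¬_; Dec; yes; no; contradiction)
open import Relation.Nullary.Decidable using (map′; _×-dec_; _⊎-dec_; ¬?; from-yes; from-no)

import Data.List.Membership.DecPropositional as DecMembership

private
  module _ {n : ℕ} where
    open DecMembership (Fin._≟_ {n}) public using (_∈?_)

-- The rainbow connection number exists

unique-resp-⊆ : ∀ {A : Set} {xs ys : List A} → xs ⊆ ys → Unique ys → Unique xs
unique-resp-⊆ []         []         = []
unique-resp-⊆ (_ ∷ʳ p)   (_ ∷ u)    = unique-resp-⊆ p u
unique-resp-⊆ (refl ∷ p) (x∉ys ∷ u) = All-resp-⊆ p x∉ys ∷ unique-resp-⊆ p u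

lookup-injective : ∀ {A : Set} {xs : List A} → Unique xs →
                   ∀ i j → lookup xs i ≡ lookup xs j → i ≡ j
lookup-injective (_ ∷ _)    zero    zero    _  = refl
lookup-injective (x∉ ∷ _)   zero    (suc j) eq = contradiction eq (All.lookup x∉ (∈-lookup j))
lookup-injective (x∉ ∷ _)   (suc i) zero    eq = contradiction (≡-sym eq) (All.lookup x∉ (∈-lookup i))
lookup-injective (_ ∷ u)    (suc i) (suc j) eq = cong suc (lookup-injective u i j eq)

unique-length≤ : ∀ {k} {xs : List (Fin k)} → Unique xs → length xs ≤ k
unique-length≤ u = injective⇒≤ (λ {i} {j} → lookup-injective u i j)

-- Deciding whether a given colouring is rainbow connected

module _ {n k : ℕ} {H : Graph n} (χ : EdgeColouring H k) where

  colour-irrelevant : ∀ {u v} (p q : Adj H u v) → colour χ p ≡ colour χ q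
  colour-irrelevant p q = trans (colour-sym χ p (sym H p)) (≡-sym (colour-sym χ q (sym H p)))

  RainbowWalk : Fin n → Fin n → Set
  RainbowWalk u v = Σ[ w ∈ Walk H u v ] Unique (colours χ w)

  suffix : ∀ {u v x} (w : Walk H u v) → x ∈ vertices w →
           Σ[ w′ ∈ Walk H x v ] (vertices w′ ⊆ vertices w × colours χ w′ ⊆ colours χ w)
  suffix w@ε       (here refl) = w , ⊆-refl , ⊆-refl
  suffix w@(_ ◅ _) (here refl) = w , ⊆-refl , ⊆-refl
  suffix (_ ◅ w)   (there x∈w) with w′ , p , q ← suffix w x∈w = w′ , _ ∷ʳ p , _ ∷ʳ q

  -- If `u` recurs in the shortened rest, the walk restarts from that occurrence. Colours are only
  -- ever dropped, so rainbow walks yield rainbow paths.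
  shortcut : ∀ {u v} (w : Walk H u v) →
             Σ[ w′ ∈ Walk H u v ] (IsPath w′ × colours χ w′ ⊆ colours χ w)
  shortcut ε = ε , [] ∷ [] , []
  shortcut {u} (e ◅ w) with w₁ , path , q ← shortcut w with u ∈? vertices w₁
  ... | yes u∈w₁ with w₂ , p , q′ ← suffix w₁ u∈w₁ =
        w₂ , unique-resp-⊆ p path , _ ∷ʳ ⊆-trans q′ q
  ... | no  u∉w₁ = e ◅ w₁ , ¬Any⇒All¬ _ u∉w₁ ∷ path , refl ∷ q

  walk⇒path : ∀ {u v} → RainbowWalk u v → RainbowPath χ u v
  walk⇒path (w , u) with w′ , path , q ← shortcut w = w′ , path , unique-resp-⊆ q u

  path⇒walk : ∀ {u v} → RainbowPath χ u v → RainbowWalk u v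
  path⇒walk (w , _ , u) = w , u

  -- The state of a depth-first search: `l` is the remaining depth and `used` holds the colours
  -- already spent on the way to `u`.
  record Bounded (l : ℕ) (used : List (Fin k)) (u v : Fin n) : Set where
    constructor bounded
    field
      walk   : Walk H u v
      unique : Unique (colours χ walk)
      unused : All (_∉ used) (colours χ walk)
      short  : length (colours χ walk) ≤ l

  bounded? : ∀ l used u v → Dec (Bounded l used u v)
  bounded? l used u v with u Fin.≟ v
  bounded? l       used u v | yes refl = yes (bounded ε [] [] z≤n)
  bounded? zero    used u v | no u≢v   = no λ where
    (bounded ε       _ _ _)  → u≢v refl
    (bounded (_ ◅ _) _ _ ())
  bounded? (suc l) used u v | no u≢v   = map′ extend first (any? step?)
    where
    Step : Fin n → Set
    Step x = Σ[ e ∈ Adj H u x ] (colour χ e ∉ used × Bounded l (colour χ e ∷ used) x v)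

    step? : ∀ x → Dec (Step x)
    step? x with adj? H u x
    ... | no ¬e = no (¬e ∘ proj₁)
    ... | yes e = map′ (e ,_) transport (¬? (colour χ e ∈? used) ×-dec bounded? l (colour χ e ∷ used) x v)
      where
      transport : Step x → colour χ e ∉ used × Bounded l (colour χ e ∷ used) x v
      transport (e′ , p) =
        -- The search tries only the adjacency proof returned by `adj?`; any other proof carries the
        -- same colour.
        subst (λ κ → κ ∉ used × Bounded l (κ ∷ used) x v) (colour-irrelevant e′ e) p

    extend : ∃[ x ] Step x → Bounded (suc l) used u v
    extend (x , e , e∉ , bounded w uniq unus sh) =
      bounded (e ◅ w) (All.map (λ c∉ eq → c∉ (here (≡-sym eq))) unus ∷ uniq)
              (e∉ ∷ All.map (_∘ there) unus) (s≤s sh)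

    first : Bounded (suc l) used u v → ∃[ x ] Step x
    first (bounded ε       _            _           _)        = contradiction refl u≢v
    first (bounded (e ◅ w) (e∉w ∷ uniq) (e∉ ∷ unus) (s≤s sh)) =
      _ , e , e∉ , bounded w uniq
        (All.zipWith (λ { (e≢c , c∉) (here eq)  → e≢c (≡-sym eq)
                        ; (e≢c , c∉) (there c∈) → c∉ c∈ }) (e∉w , unus)) sh

  rainbowWalk? : ∀ u v → Dec (RainbowWalk u v)
  rainbowWalk? u v = map′ (λ b → Bounded.walk b , Bounded.unique b)
    -- Depth `k` is exhaustive, since a rainbow walk has at most `k` edges.
    (λ (w , uniq) → bounded w uniq (All.universal (λ _ ()) _) (unique-length≤ uniq))
    (bounded? k [] u v)

  rainbowConnected? : Dec (RainbowConnected χ)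
  rainbowConnected? = all? λ u → all? λ v → map′ walk⇒path path⇒walk (rainbowWalk? u v)

-- Exhaustive search over colourings

module _ {n k : ℕ} {H : Graph n} {χ χ′ : EdgeColouring H k}
         (χ≗χ′ : ∀ {u v} (e : Adj H u v) → colour χ e ≡ colour χ′ e) where

  colours-cong : ∀ {u v} (w : Walk H u v) → colours χ w ≡ colours χ′ w
  colours-cong ε       = refl
  colours-cong (e ◅ w) = cong₂ _∷_ (χ≗χ′ e) (colours-cong w)

  rainbowConnected-resp : RainbowConnected χ → RainbowConnected χ′
  rainbowConnected-resp rc u v with w , path , uniq ← rc u v =
    w , path , subst Unique (colours-cong w) uniq

module _ {n : ℕ} (H : Graph n) where

  module _ {k : ℕ} where

    -- Colour matrices are coded by numbers, so that a search over all of them is a search over a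
    -- finite type.
    table : Fin (suc k ^ (n * n)) → Fin n → Fin n → Fin (suc k)
    table code u v = finToFun code (combine u v)

    Symmetricᵗ : Fin (suc k ^ (n * n)) → Set
    Symmetricᵗ code = ∀ u v → table code u v ≡ table code v u

    decode : ∀ code → Symmetricᵗ code → EdgeColouring H (suc k)
    decode code s = record { colour = λ {u} {v} _ → table code u v ; colour-sym = λ {u} {v} _ _ → s u v }

    module _ (χ : EdgeColouring H (suc k)) where

      entry : Fin n → Fin n → Fin (suc k)
      entry u v with adj? H u v
      ... | yes e = colour χ e
      -- A filler for pairs that are not edges; it exists because there is at least one colour.
      ... | no  _ = zero

      entry-colour : ∀ {u v} (e : Adj H u v) → colour χ e ≡ entry u v
      entry-colour {u} {v} e with adj? H u v
      ... | yes e′ = colour-irrelevant χ e e′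
      ... | no  ¬e = contradiction e ¬e

      entry-sym : ∀ u v → entry u v ≡ entry v u
      entry-sym u v with adj? H u v | adj? H v u
      ... | yes e | yes e′ = colour-sym χ e e′
      ... | yes e | no  ¬e = contradiction (sym H e) ¬e
      ... | no ¬e | yes e  = contradiction (sym H e) ¬e
      ... | no _  | no _   = refl

      encode : Fin (suc k ^ (n * n))
      encode = funToFin {n * n} {suc k} (λ i → let (u , v) = remQuot n i in entry u v)

      table-encode : ∀ u v → table encode u v ≡ entry u v
      table-encode u v = trans (finToFun-funToFin {n * n} {suc k} _ (combine u v))
        (cong (λ (u , v) → entry u v) (remQuot-combine u v))

      encode-symmetric : Symmetricᵗ encode
      encode-symmetric u v = trans (table-encode u v) (trans (entry-sym u v) (≡-sym (table-encode v u)))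

  rainbowColourable-suc? : ∀ k → Dec (RainbowColourable H (suc k))
  rainbowColourable-suc? k = map′ (λ (code , s , rc) → decode code s , rc) encoded (any? good?)
    where
    Good : Fin (suc k ^ (n * n)) → Set
    Good code = Σ[ s ∈ Symmetricᵗ code ] RainbowConnected (decode code s)

    symmetric? : ∀ code → Dec (Symmetricᵗ code)
    symmetric? code = all? λ u → all? λ v → table code u v Fin.≟ table code v u

    good? : ∀ code → Dec (Good code)
    good? code with symmetric? code
    ... | no ¬s = no (¬s ∘ proj₁)
    ... | yes s = map′ (s ,_)
      (λ (s′ , rc) → rainbowConnected-resp {χ = decode code s′} {decode code s} (λ _ → refl) rc)
      (rainbowConnected? (decode code s))

    encoded : RainbowColourable H (suc k) → ∃[ code ] Good code
    encoded (χ , rc) = encode χ , encode-symmetric χ ,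
      rainbowConnected-resp {χ = χ} {decode (encode χ) (encode-symmetric χ)}
        (λ {u} {v} e → trans (entry-colour χ e) (≡-sym (table-encode χ u v))) rc

-- Two distinct vertices need a walk with a first edge, and that edge would have a colour in
-- `Fin 0`.
rainbowColourable-0? : ∀ {n} (H : Graph n) → Dec (RainbowColourable H 0)
rainbowColourable-0? {zero} H =
  yes (record { colour = λ {} ; colour-sym = λ {} } , λ ())
rainbowColourable-0? {suc zero} H =
  yes (record { colour = λ { {zero} {zero} e → contradiction e (irrefl H refl) }
              ; colour-sym = λ { {zero} {zero} e → contradiction e (irrefl H refl) } }
      , λ { zero zero → ε , [] ∷ [] , [] })
rainbowColourable-0? {suc (suc n)} H = no λ (χ , rc) → colourless χ (proj₁ (rc zero (suc zero)))
  where
  colourless : EdgeColouring H 0 → ¬ Walk H zero (suc zero)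
  colourless χ (e ◅ _) with () ← colour χ e

rainbowColourable? : ∀ {n} (H : Graph n) k → Dec (RainbowColourable H k)
rainbowColourable? H zero    = rainbowColourable-0? H
rainbowColourable? H (suc k) = rainbowColourable-suc? H k

least : ∀ {P : ℕ → Set} → (∀ k → Dec (P k)) → ∀ {k} → P k →
        ∃[ r ] ((P r × (∀ j → P j → r ≤ j)) × r ≤ k)
least P? {zero}  p0 = 0 , (p0 , λ _ _ → z≤n) , z≤n
least {P} P? {suc k} pk with P? 0
... | yes p0 = 0 , (p0 , λ _ _ → z≤n) , z≤n
... | no ¬p0 with r , (pr , min) , r≤k ← least (P? ∘ suc) pk =
      suc r , (pr , λ { zero p0 → contradiction p0 ¬p0 ; (suc j) pj → s≤s (min j pj) }) , s≤s r≤k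

rainbowConnectionNumber : ∀ {n} {H : Graph n} {k} → RainbowColourable H k →
                          ∃[ r ] (IsRainbowConnectionNumber H r × r ≤ k)
rainbowConnectionNumber {H = H} = least (rainbowColourable? H)

-- Stars of the line graph

two-members⇒2≤length : ∀ {A : Set} {x y : A} {xs} → x ∈ xs → y ∈ xs → x ≢ y → 2 ≤ length xs
two-members⇒2≤length (here refl) (here refl) x≢y = contradiction refl x≢y
two-members⇒2≤length (here _)    (there y∈)  _   = s≤s (∈-length y∈)
two-members⇒2≤length (there x∈)  (here _)    _   = s≤s (∈-length x∈)
two-members⇒2≤length (there x∈)  (there y∈)  x≢y = ℕ.m≤n⇒m≤1+n (two-members⇒2≤length x∈ y∈ x≢y)

-- Two distinct members fix a pair up to order, and the increasing order excludes the swap.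
ordered-pair-unique : ∀ {n} {a b c d u v : Fin n} → a Fin.< b → c Fin.< d → u ≢ v →
                      u ∈ endpoints (a , b) → v ∈ endpoints (a , b) →
                      u ∈ endpoints (c , d) → v ∈ endpoints (c , d) → (a , b) ≡ (c , d)
ordered-pair-unique _   _   u≢v (here refl)         (here refl)         _ _ = contradiction refl u≢v
ordered-pair-unique _   _   u≢v (there (here refl)) (there (here refl)) _ _ = contradiction refl u≢v
ordered-pair-unique _   _   u≢v _ _ (here refl)         (here refl)         = contradiction refl u≢v
ordered-pair-unique _   _   u≢v _ _ (there (here refl)) (there (here refl)) = contradiction refl u≢v
ordered-pair-unique _   _   _ (here refl) (there (here refl)) (here refl) (there (here refl)) = refl
ordered-pair-unique _   _   _ (there (here refl)) (here refl) (there (here refl)) (here refl) = refl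
ordered-pair-unique a<b c<d _ (here refl) (there (here refl)) (there (here refl)) (here refl) =
  contradiction c<d (Fin.<-asym a<b)
ordered-pair-unique a<b c<d _ (there (here refl)) (here refl) (here refl) (there (here refl)) =
  contradiction c<d (Fin.<-asym a<b)

endpoints-pigeonhole : ∀ {n} {e : Fin n × Fin n} {u v w} → u ≢ v →
                       u ∈ endpoints e → v ∈ endpoints e → w ∈ endpoints e → w ≡ u ⊎ w ≡ v
endpoints-pigeonhole u≢v (here refl)         (here refl)         _ = contradiction refl u≢v
endpoints-pigeonhole u≢v (there (here refl)) (there (here refl)) _ = contradiction refl u≢v
endpoints-pigeonhole _ (here refl)         (there (here refl)) (here refl)         = inj₁ refl
endpoints-pigeonhole _ (here refl)         (there (here refl)) (there (here refl)) = inj₂ refl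
endpoints-pigeonhole _ (there (here refl)) (here refl)         (here refl)         = inj₂ refl
endpoints-pigeonhole _ (there (here refl)) (here refl)         (there (here refl)) = inj₁ refl

unique-reverse : ∀ {A : Set} {xs : List A} → Unique xs → Unique (reverse xs)
unique-reverse {A} {xs} = Permutation.Unique-resp-↭ (setoid A) (↭⇒↭ₛ (↭-sym (↭-reverse xs)))

module _ {A : Set} {P Q : A → Set} (P? : ∀ x → Dec (P x)) (Q? : ∀ x → Dec (Q x))
         (Q⇒P : ∀ {x} → Q x → P x) where

  filter-mono-≤ : ∀ xs → length (filter Q? xs) ≤ length (filter P? xs)
  filter-mono-≤ [] = z≤n
  filter-mono-≤ (x ∷ xs) with Q? x | P? x
  ... | yes _ | yes _ = s≤s (filter-mono-≤ xs)
  ... | yes q | no ¬p = contradiction (Q⇒P q) ¬p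
  ... | no  _ | yes _ = ℕ.m≤n⇒m≤1+n (filter-mono-≤ xs)
  ... | no  _ | no _  = filter-mono-≤ xs

  filter-mono-< : ∀ {x xs} → x ∈ xs → P x → ¬ Q x → length (filter Q? xs) < length (filter P? xs)
  filter-mono-< {x} {y ∷ xs} x∈ p ¬q with Q? y | P? y | x∈
  ... | yes q | _     | here refl = contradiction q ¬q
  ... | no _  | no ¬p | here refl = contradiction p ¬p
  ... | no _  | yes _ | here refl = s≤s (filter-mono-≤ xs)
  ... | yes _ | yes _ | there x∈′ = s≤s (filter-mono-< x∈′ p ¬q)
  ... | yes q | no ¬p | there _   = contradiction (Q⇒P q) ¬p
  ... | no  _ | yes _ | there x∈′ = ℕ.m≤n⇒m≤1+n (filter-mono-< x∈′ p ¬q)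
  ... | no  _ | no _  | there x∈′ = filter-mono-< x∈′ p ¬q

module _ {n : ℕ} (G : Graph n) where

  V = Fin n
  E = Fin (length (edges G))

  infix 4 _on_
  _on_ : V → E → Set
  v on e = v ∈ endpoints (lookup (edges G) e)

  edges-unique : Unique (edges G)
  edges-unique = Unique.filter⁺ _ (Unique.cartesianProduct⁺ (Unique.allFin⁺ n) (Unique.allFin⁺ n))

  lookup-edge : ∀ e → let (u , v) = lookup (edges G) e in u Fin.< v × Adj G u v
  lookup-edge e = proj₂ (∈-filter⁻ _ {xs = cartesianProduct (allFin n) (allFin n)} (∈-lookup e))

  edge-determined : ∀ {u v i j} → u ≢ v → u on i → v on i → u on j → v on j → i ≡ j
  edge-determined {i = i} {j} u≢v ui vi uj vj = lookup-injective edges-unique i j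
    (ordered-pair-unique (proj₁ (lookup-edge i)) (proj₁ (lookup-edge j)) u≢v ui vi uj vj)

  -- Because `G` is simple, every edge of L(G) lies in exactly one star, so colouring star by star
  -- is consistent.
  common-end-unique : ∀ {u v i j} → i ≢ j → u on i → u on j → v on i → v on j → u ≡ v
  common-end-unique {u} {v} i≢j ui uj vi vj with u Fin.≟ v
  ... | yes u≡v = u≡v
  ... | no  u≢v = contradiction (edge-determined u≢v ui vi uj vj) i≢j

  ordered-edge : ∀ {u v} → u Fin.< v → Adj G u v → ∃[ e ] (u on e × v on e)
  ordered-edge {u} {v} u<v uv = Any.index uv∈ , at (here refl) , at (there (here refl))
    where
    uv∈ : (u , v) ∈ edges G
    uv∈ = ∈-filter⁺ _ (∈-cartesianProduct⁺ (∈-allFin u) (∈-allFin v)) (u<v , uv)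
    at : ∀ {w} → w ∈ endpoints (u , v) → w on Any.index uv∈
    at = subst (λ e → _ ∈ endpoints e) (lookup-index uv∈)

  edge-of : ∀ {u v} → Adj G u v → ∃[ e ] (u on e × v on e)
  edge-of {u} {v} uv with Fin.<-cmp u v
  ... | tri< u<v _ _ = ordered-edge u<v uv
  ... | tri≈ _ u≡v _ = contradiction uv (irrefl G u≡v)
  ... | tri> _ _ v<u with e , ve , ue ← ordered-edge v<u (sym G uv) = e , ue , ve

  ends : ∀ e → Σ[ u ∈ V ] Σ[ v ∈ V ] (Adj G u v × u on e × v on e)
  ends e = _ , _ , proj₂ (lookup-edge e) , here refl , there (here refl)

  adjacent⇒≢ : ∀ {u v} → Adj G u v → u ≢ v
  adjacent⇒≢ uv u≡v = irrefl G u≡v uv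

  other-end : ∀ {u e} → u on e → ∃[ t ] (Adj G u t × t on e)
  other-end {e = e} ue with a , b , ab , ae , be ← ends e
    with endpoints-pigeonhole (adjacent⇒≢ ab) ae be ue
  ... | inj₁ refl = b , ab , be
  ... | inj₂ refl = a , sym G ab , ae

  two-neighbours : ∀ {w u v} → Adj G w u → Adj G w v → u ≢ v → 2 ≤ degree G w
  two-neighbours wu wv = two-members⇒2≤length
    (∈-filter⁺ (adj? G _) (∈-allFin _) wu) (∈-filter⁺ (adj? G _) (∈-allFin _) wv)

  -- Colours of the edges ij of L(G), indexed also by the common end w of i and j.
  StarColouring : Set
  StarColouring = V → E → E → ℕ

  -- Walks of L(G) that use only edges of the stars centred in S. They may pause
  -- at an edge of G (i ≡ j is allowed), which saves case distinctions.
  data Chain (col : StarColouring) (S : List V) : E → E → List ℕ → Set where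
    []   : ∀ {i} → Chain col S i i []
    step : ∀ {w i j l κ cs} → w ∈ S → w on i → w on j → col w i j ≡ κ →
           Chain col S j l cs → Chain col S i l (κ ∷ cs)

  RainbowChain : StarColouring → List V → E → E → Set
  RainbowChain col S i j = ∃[ cs ] (Chain col S i j cs × Unique cs)

  Meets : List V → E → Set
  Meets S e = ∃[ w ] (w ∈ S × w on e)

  meets-singleton : ∀ {v e} → Meets (v ∷ []) e → v on e
  meets-singleton (_ , here refl , ve) = ve

  -- The invariant kept while `S` grows. Edges with only one end in `S` are covered too. Colours are
  -- naturals with a separate bound, so old colours persist unchanged when `k` increases.
  record Linked (S : List V) (k : ℕ) : Set where
    field
      col         : StarColouring
      symmetric   : ∀ w i j → col w i j ≡ col w j i
      bound       : ∀ w i j → col w i j < k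
      rainbow     : ∀ {i j} → Meets S i → Meets S j → RainbowChain col S i j

  open Linked

  module _ {col : StarColouring} {S : List V} (symm : ∀ w i j → col w i j ≡ col w j i) where

    -- Reversal with the second chain as accumulator; symmetry of `col` keeps each colour when its
    -- step is turned round.
    chain-rev : ∀ {i j l cs ds} → Chain col S i j cs → Chain col S i l ds → Chain col S j l (cs ʳ++ ds)
    chain-rev []                      d = d
    chain-rev (step w∈S wi wj refl c) d = chain-rev c (step w∈S wj wi (symm _ _ _) d)

    rainbow-sym : ∀ {i j} → RainbowChain col S i j → RainbowChain col S j i
    rainbow-sym (cs , c , u) = reverse cs , chain-rev c [] , unique-reverse u

  one-step : ∀ {col S w i j} → w ∈ S → w on i → w on j → RainbowChain col S i j
  one-step w∈S wi wj = _ , step w∈S wi wj refl [] , [] ∷ []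

  chain-bound : ∀ {col S k i j cs} → (∀ w i j → col w i j < k) → Chain col S i j cs → All (_< k) cs
  chain-bound b []                   = []
  chain-bound b (step _ _ _ refl c) = b _ _ _ ∷ chain-bound b c

  chain-mono : ∀ {col col′ S S′} → (∀ {w} → w ∈ S → w ∈ S′) →
               (∀ {w} → w ∈ S → ∀ i j → col′ w i j ≡ col w i j) →
               ∀ {i j cs} → Chain col S i j cs → Chain col′ S′ i j cs
  chain-mono S⊆ ext []                       = []
  chain-mono S⊆ ext (step w∈S wi wj refl c) =
    step (S⊆ w∈S) wi wj (ext w∈S _ _) (chain-mono S⊆ ext c)

  -- A star is a clique of L(G), so one step joins any two of its edges.
  linked-start : ∀ v → Linked (v ∷ []) 1
  linked-start v = record
    { col       = λ _ _ _ → 0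
    ; symmetric = λ _ _ _ → refl
    ; bound     = λ _ _ _ → s≤s z≤n
    ; rainbow   = λ { (_ , here refl , vi) (_ , here refl , vj) → one-step (here refl) vi vj }
    }

  -- Enlarging a linked set at the cost of one colour

  module Extension {S : List V} {k : ℕ} (L : Linked S k) (new : StarColouring)
    (new-sym : ∀ w i j → new w i j ≡ new w j i) (new≤k : ∀ w i j → new w i j ≤ k) where

    -- Stars centred in `S` keep their colours. The others follow `new`, which may use the fresh
    -- colour `k` or reuse old ones.
    col′ : StarColouring
    col′ w i j with w ∈? S
    ... | yes _ = col L w i j
    ... | no  _ = new w i j

    col′-sym : ∀ w i j → col′ w i j ≡ col′ w j i
    col′-sym w i j with w ∈? S
    ... | yes _ = symmetric L w i j
    ... | no  _ = new-sym w i j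

    col′-bound : ∀ w i j → col′ w i j < suc k
    col′-bound w i j with w ∈? S
    ... | yes _ = ℕ.m≤n⇒m≤1+n (bound L w i j)
    ... | no  _ = s≤s (new≤k w i j)

    col′-old : ∀ {w} → w ∈ S → ∀ i j → col′ w i j ≡ col L w i j
    col′-old {w} w∈S i j with w ∈? S
    ... | yes _ = refl
    ... | no w∉ = contradiction w∈S w∉

    col′-new : ∀ {w} → w ∉ S → ∀ {i j κ} → new w i j ≡ κ → col′ w i j ≡ κ
    col′-new {w} w∉S eq with w ∈? S
    ... | yes w∈ = contradiction w∈ w∉S
    ... | no  _  = eq

    module _ {S′ : List V} (S⊆S′ : ∀ {w} → w ∈ S → w ∈ S′) where

      old : ∀ {i j} → Meets S i → Meets S j → RainbowChain col′ S′ i j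
      old mi mj with cs , c , u ← rainbow L mi mj = cs , chain-mono S⊆S′ col′-old c , u

      -- One step of colour `k` leads to the gateway `h`, and an old chain continues from there. Its
      -- colours are all below `k`, so none is repeated.
      enter : ∀ {w i h j} → w ∈ S′ → w ∉ S → new w i h ≡ k → w on i → w on h →
              Meets S h → Meets S j → RainbowChain col′ S′ i j
      enter w∈S′ w∉S eq wi wh mh mj with cs , c , u ← rainbow L mh mj =
        k ∷ cs , step w∈S′ wi wh (col′-new w∉S eq) (chain-mono S⊆S′ col′-old c) ,
        All.map (λ c<k k≡c → ℕ.<⇒≢ c<k (≡-sym k≡c)) (chain-bound (bound L) c) ∷ u

  -- The edge `sw` belongs to the star of `w` and meets `S`, so it is a gateway for every edge at
  -- `w`.
  linked-vertex : ∀ {S k s w} → Linked S k → s ∈ S → w ∉ S → Adj G s w → Linked (w ∷ S) (suc k)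
  linked-vertex {S} {k} {s} {w} L s∈S w∉S sw with e , se , we ← edge-of sw = record
    { col = col′ ; symmetric = col′-sym ; bound = col′-bound ; rainbow = joined }
    where
    open Extension L (λ _ _ _ → k) (λ _ _ _ → refl) (λ _ _ _ → ℕ.≤-refl)

    from-star : ∀ {i j} → w on i → Meets S j → RainbowChain col′ (w ∷ S) i j
    from-star wi = enter there (here refl) w∉S refl wi we (s , s∈S , se)

    joined : ∀ {i j} → Meets (w ∷ S) i → Meets (w ∷ S) j → RainbowChain col′ (w ∷ S) i j
    joined (_ , here refl , wi) (_ , here refl , wj) = one-step (here refl) wi wj
    joined (_ , here refl , wi) (v , there v∈S , vj) = from-star wi (v , v∈S , vj)
    joined (v , there v∈S , vi) (_ , here refl , wj) = rainbow-sym col′-sym (from-star wj (v , v∈S , vi))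
    joined (u , there u∈S , ui) (v , there v∈S , vj) = old there (u , u∈S , ui) (v , v∈S , vj)

  -- One new colour k serves two stars at once: in the star of x the edges of
  -- L(G) at e = xy reuse colour 0, all others in the stars of x and y get k.
  -- Then i – e – j with x on i and y on j has colours 0 and k.
  linked-triangle : ∀ {S k p x y} → Linked S k → p ∈ S → x ∉ S → y ∉ S →
                    Adj G p x → Adj G p y → Adj G x y → Linked (x ∷ y ∷ S) (suc k)
  linked-triangle {S} {k} {p} {x} {y} L p∈S x∉S y∉S px py xy
    with e , xe , ye ← edge-of xy | a , pa , xa ← edge-of px | b , pb , yb ← edge-of py = record
    { col = col′ ; symmetric = col′-sym ; bound = col′-bound ; rainbow = joined }
    where
    0<k : 0 < k
    -- Any value of the old colouring witnesses that `k` is positive; hence the reused colour 0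
    -- differs from `k`.
    0<k = ℕ.≤-<-trans z≤n (bound L p e e)

    AtXY : V → E → E → Set
    AtXY w i j = w ≡ x × (i ≡ e ⊎ j ≡ e)

    atXY? : ∀ w i j → Dec (AtXY w i j)
    atXY? w i j = w Fin.≟ x ×-dec (i Fin.≟ e ⊎-dec j Fin.≟ e)

    new : StarColouring
    new w i j with atXY? w i j
    ... | yes _ = 0
    ... | no  _ = k

    new-sym : ∀ w i j → new w i j ≡ new w j i
    new-sym w i j with atXY? w i j | atXY? w j i
    ... | yes _          | yes _          = refl
    ... | yes (w≡x , at) | no ¬at         = contradiction (w≡x , [ inj₂ , inj₁ ]′ at) ¬at
    ... | no ¬at         | yes (w≡x , at) = contradiction (w≡x , [ inj₂ , inj₁ ]′ at) ¬at
    ... | no _           | no _           = refl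

    new≤k : ∀ w i j → new w i j ≤ k
    new≤k w i j with atXY? w i j
    ... | yes _ = z≤n
    ... | no  _ = ℕ.≤-refl

    new-0 : ∀ {i} → new x i e ≡ 0
    new-0 {i} with atXY? x i e
    ... | yes _  = refl
    ... | no ¬at = contradiction (refl , inj₂ refl) ¬at

    new-x : ∀ {i j} → i ≢ e → j ≢ e → new x i j ≡ k
    new-x {i} {j} i≢e j≢e with atXY? x i j
    ... | yes (_ , at) = contradiction at [ i≢e , j≢e ]′
    ... | no _         = refl

    new-y : ∀ {i j} → new y i j ≡ k
    new-y {i} {j} with atXY? y i j
    ... | yes (y≡x , _) = contradiction (≡-sym y≡x) (adjacent⇒≢ xy)
    ... | no _          = refl

    open Extension L new new-sym new≤k

    S′ : List V
    S′ = x ∷ y ∷ S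

    S⊆S′ : ∀ {w} → w ∈ S → w ∈ S′
    S⊆S′ = there ∘ there

    a≢e : a ≢ e
    a≢e refl with endpoints-pigeonhole (adjacent⇒≢ xy) xe ye pa
    ... | inj₁ p≡x = adjacent⇒≢ px p≡x
    ... | inj₂ p≡y = adjacent⇒≢ py p≡y

    -- The edge `e` itself is filed under `y`: a step from it in the star of `x` would get colour 0,
    -- which the old chain may contain.
    data Position (i : E) : Set where
      atX : x on i → i ≢ e → Position i
      atY : y on i → Position i
      atS : Meets S i → Position i

    position : ∀ {i} → Meets S′ i → Position i
    position {i} (_ , here refl , xi) with i Fin.≟ e
    ... | yes refl = atY ye
    ... | no  i≢e  = atX xi i≢e
    position (_ , there (here refl) , yi)  = atY yi
    position (w , there (there w∈S) , wi)  = atS (w , w∈S , wi)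

    x→S : ∀ {i j} → x on i → i ≢ e → Meets S j → RainbowChain col′ S′ i j
    -- The gateway is `a = px`. As neither `i` nor `a` is `e`, the step between them has the fresh
    -- colour.
    x→S xi i≢e = enter S⊆S′ (here refl) x∉S (new-x i≢e a≢e) xi xa (p , p∈S , pa)

    y→S : ∀ {i j} → y on i → Meets S j → RainbowChain col′ S′ i j
    y→S yi = enter S⊆S′ (there (here refl)) y∉S new-y yi yb (p , p∈S , pb)

    x→y : ∀ {i j} → x on i → y on j → RainbowChain col′ S′ i j
    x→y xi yj = 0 ∷ k ∷ [] ,
      step (here refl) xi xe (col′-new x∉S new-0) (step (there (here refl)) ye yj (col′-new y∉S new-y) []) ,
      (ℕ.<⇒≢ 0<k ∷ []) ∷ [] ∷ []

    between : ∀ {i j} → Position i → Position j → RainbowChain col′ S′ i j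
    between (atX xi _)   (atX xj _)   = one-step (here refl) xi xj
    between (atX xi _)   (atY yj)     = x→y xi yj
    between (atX xi i≢e) (atS mj)     = x→S xi i≢e mj
    between (atY yi)     (atX xj _)   = rainbow-sym col′-sym (x→y xj yi)
    between (atY yi)     (atY yj)     = one-step (there (here refl)) yi yj
    between (atY yi)     (atS mj)     = y→S yi mj
    between (atS mi)     (atX xj j≢e) = rainbow-sym col′-sym (x→S xj j≢e mi)
    between (atS mi)     (atY yj)     = rainbow-sym col′-sym (y→S yj mi)
    between (atS mi)     (atS mj)     = old S⊆S′ mi mj

    joined : ∀ {i j} → Meets S′ i → Meets S′ j → RainbowChain col′ S′ i j
    joined mi mj = between (position mi) (position mj)

  -- From a linked set meeting every edge to a rainbow colouring

  linked⇒colourable : ∀ {S k} → Linked S k → (∀ i → Meets S i) → RainbowColourable (lineGraph G) k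
  linked⇒colourable {S} {k} L meets = χ , connected
    where
    χ : EdgeColouring (lineGraph G) k
    χ = record
      { colour     = λ { {i} {j} (_ , w , _) → fromℕ< (bound L w i j) }
      ; colour-sym = λ { {i} {j} (i≢j , w , wi , wj) (_ , w′ , w′j , w′i) →
          fromℕ<-cong _ _
            -- The two adjacency proofs may name their common end separately, but it is the same
            -- vertex.
            (trans (cong (λ v → col L v i j) (common-end-unique i≢j wi wj w′i w′j)) (symmetric L w′ i j))
            (bound L w i j) (bound L w′ j i) }
      }

    chain⇒walk : ∀ {i j cs} → Chain (col L) S i j cs →
                 Σ[ w ∈ Walk (lineGraph G) i j ] (map toℕ (colours χ w) ⊆ cs)
    chain⇒walk [] = ε , []
    chain⇒walk (step {w} {i} {j} _ wi wj refl c) with walk , q ← chain⇒walk c | i Fin.≟ j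
    -- A pause contributes no edge of L(G); dropping its colour keeps the remaining ones distinct.
    ... | yes refl = walk , _ ∷ʳ q
    ... | no i≢j   = (i≢j , w , wi , wj) ◅ walk , toℕ-fromℕ< (bound L w i j) ∷ q

    connected : RainbowConnected χ
    connected i j with _ , c , u ← rainbow L (meets i) (meets j) with w , q ← chain⇒walk c =
      walk⇒path χ (w , Unique.map⁻ (unique-resp-⊆ q u))

  -- Sets that cannot grow meet every edge

  Frontier : List V → V → Set
  Frontier S w = 2 ≤ degree G w × w ∉ S × (∃[ s ] (s ∈ S × Adj G s w))

  frontier? : ∀ S w → Dec (Frontier S w)
  frontier? S w = 2 ℕ.≤? degree G w ×-dec ¬? (w ∈? S) ×-dec any? (λ s → s ∈? S ×-dec adj? G s w)

  module _ {S : List V} (closed : ∀ w → ¬ Frontier S w) where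

    Dominated : V → Set
    Dominated v = v ∈ S ⊎ (∃[ s ] (s ∈ S × Adj G s v))

    -- If `u` lies outside `S` next to some `s` in `S`, a further neighbour `v` of `u` would give
    -- `u` degree at least 2 and put it on the frontier. So the walk can only go back to `s`.
    dominated-walk : ∀ {u v} → Walk G u v → Dominated u → Dominated v
    dominated-walk ε           d          = d
    dominated-walk (uv ◅ walk) (inj₁ u∈S) = dominated-walk walk (inj₂ (_ , u∈S , uv))
    dominated-walk (_◅_ {u} {v} uv walk) (inj₂ (s , s∈S , su)) with s Fin.≟ v | u ∈? S
    ... | yes refl | _       = dominated-walk walk (inj₁ s∈S)
    ... | no _     | yes u∈S = dominated-walk walk (inj₂ (u , u∈S , uv))
    ... | no s≢v   | no u∉S  =
      contradiction (two-neighbours (sym G su) uv s≢v , u∉S , s , s∈S , su) (closed u)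

    closed⇒meets : ∀ {s} → s ∈ S → (∀ v → Walk G s v) → ∀ i → Meets S i
    closed⇒meets s∈S walks i with u , v , uv , ui , vi ← ends i with dominated-walk (walks u) (inj₁ s∈S)
    ... | inj₁ u∈S = u , u∈S , ui
    ... | inj₂ (t , t∈S , tu) with t Fin.≟ v | u ∈? S
    ...   | yes refl | _       = t , t∈S , vi
    ...   | no _     | yes u∈S = u , u∈S , ui
    ...   | no t≢v   | no u∉S  =
      contradiction (two-neighbours (sym G tu) uv t≢v , u∉S , t , t∈S , tu) (closed u)

  -- Without degrees of at least 2 no set has a frontier, so an end `u` of `i` already meets every
  -- edge; two different edges at `u` would give it degree 2.
  edges-equal : (∀ u v → Walk G u v) → (∀ v → ¬ 2 ≤ degree G v) → ∀ (i j : E) → i ≡ j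
  edges-equal walks low i j with i Fin.≟ j
  ... | yes i≡j = i≡j
  ... | no  i≢j with u , v , uv , ui , vi ← ends i
    with uj ← meets-singleton (closed⇒meets (λ w (2≤w , _) → low w 2≤w) (here refl) (walks u) j)
    with t , ut , tj ← other-end uj =
      contradiction (two-neighbours uv ut λ
        { refl → i≢j (edge-determined (adjacent⇒≢ uv) ui vi uj tj) }) (low u)

  -- Charging colours to triangles, vertices and components

  module Growth (𝒯 : List (Triangle G)) (m : ℕ) (components : HasComponents 𝒯 m) where

    open Bijection components using (to; injective) renaming (cong to to-cong)

    Uncovered : V → Set
    Uncovered v = 2 ≤ degree G v × ¬ OnTriangle 𝒯 v

    uncovered? : ∀ v → Dec (Uncovered v)
    uncovered? v = 2 ℕ.≤? degree G v ×-dec ¬? (onTriangle? 𝒯 v)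

    -- Every new colour is charged to one of these.
    data Item : Set where
      triangle  : Triangle G → Item
      vertex    : V → Item
      component : Fin m → Item

    items : List Item
    items = (map triangle 𝒯 ++ map vertex (filter uncovered? (allFin n))) ++ map component (allFin m)

    triangle-item : ∀ {Δ} → Δ ∈ 𝒯 → triangle Δ ∈ items
    triangle-item Δ∈ = ∈-++⁺ˡ (∈-++⁺ˡ (∈-map⁺ triangle Δ∈))

    vertex-item : ∀ {v} → Uncovered v → vertex v ∈ items
    vertex-item unc =
      ∈-++⁺ˡ (∈-++⁺ʳ (map triangle 𝒯) (∈-map⁺ vertex (∈-filter⁺ uncovered? (∈-allFin _) unc)))

    component-item : ∀ κ → component κ ∈ items
    component-item κ = ∈-++⁺ʳ (map triangle 𝒯 ++ _) (∈-map⁺ component (∈-allFin κ))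

    length-items : length items ≡ length 𝒯 + n₂′ G 𝒯 + m
    length-items = trans (length-++ (map triangle 𝒯 ++ _)) (cong₂ _+_
      (trans (length-++ (map triangle 𝒯)) (cong₂ _+_
        (length-map triangle 𝒯) (length-map vertex (filter uncovered? (allFin n)))))
      (trans (length-map component (allFin m)) (length-tabulate id)))

    In : Fin m → V → Set
    In κ v = Σ[ on ∈ OnTriangle 𝒯 v ] to (v , on) ≡ κ

    in? : ∀ κ v → Dec (In κ v)
    in? κ v with onTriangle? 𝒯 v
    ... | no ¬on = no (¬on ∘ proj₁)
    -- Two proofs that `v` is on a triangle are related by the empty walk, so `to` gives them the
    -- same component.
    ... | yes on = map′ (on ,_) (λ (on′ , eq) → trans (to-cong {v , on} {v , on′} ε) eq)
                        (to (v , on) Fin.≟ κ)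

    Done : List V → Item → Set
    Done S (triangle Δ)  = All (_∈ S) (corners Δ)
    Done S (vertex v)    = v ∈ S
    Done S (component κ) = ∃[ v ] (v ∈ S × In κ v)

    done? : ∀ S x → Dec (Done S x)
    done? S (triangle Δ)  = All.all? (_∈? S) (corners Δ)
    done? S (vertex v)    = v ∈? S
    done? S (component κ) = any? λ v → v ∈? S ×-dec in? κ v

    done-mono : ∀ {S S′} → (∀ {w} → w ∈ S → w ∈ S′) → ∀ x → Done S x → Done S′ x
    done-mono S⊆S′ (triangle Δ)  d               = All.map S⊆S′ d
    done-mono S⊆S′ (vertex v)    d               = S⊆S′ d
    done-mono S⊆S′ (component κ) (v , v∈S , inκ) = v , S⊆S′ v∈S , inκ

    -- The potential that pays for new colours.
    undone : List V → ℕ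
    undone S = length (filter (¬? ∘ done? S) items)

    record Advance (S S′ : List V) : Set where
      constructor advance
      field
        {item}  : Item
        grows   : ∀ {w} → w ∈ S → w ∈ S′
        member  : item ∈ items
        ¬before : ¬ Done S item
        after   : Done S′ item

    undone-< : ∀ {S S′} → Advance S S′ → undone S′ < undone S
    undone-< {S} {S′} (advance grows member ¬before after) =
      filter-mono-< (¬? ∘ done? S) (¬? ∘ done? S′) (λ {x} ¬d d → ¬d (done-mono grows x d))
        member ¬before (λ ¬d → ¬d after)

    Fresh : List V → V → Set
    Fresh S w = ∀ (on : OnTriangle 𝒯 w) → ¬ Done S (component (to (w , on)))

    -- Off the triangles `w` completes its own item; on a triangle it is the first vertex of its
    -- component to be reached.
    advance-fresh : ∀ {S w} → 2 ≤ degree G w → w ∉ S → Fresh S w → Advance S (w ∷ S)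
    advance-fresh {S} {w} 2≤w w∉S fresh with onTriangle? 𝒯 w
    ... | no ¬on = advance there (vertex-item (2≤w , ¬on)) w∉S (here refl)
    ... | yes on = advance there (component-item (to (w , on))) (fresh on) (w , here refl , on , refl)

    crossing : ∀ {S u v} → Star (TriangleEdge 𝒯) u v → u ∈ S → v ∉ S →
               ∃[ a ] ∃[ b ] (TriangleEdge 𝒯 a b × a ∈ S × b ∉ S)
    crossing ε u∈S v∉S = contradiction u∈S v∉S
    crossing {S} (_◅_ {j = w} uw walk) u∈S v∉S with w ∈? S
    ... | yes w∈S = crossing walk w∈S v∉S
    ... | no  w∉S = _ , w , uw , u∈S , w∉S

    record Completion (Δ : Triangle G) (u v : V) : Set where
      constructor completion
      field
        third : V
        uv    : Adj G u v
        ut    : Adj G u third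
        vt    : Adj G v third
        cover : ∀ {S} → u ∈ S → v ∈ S → third ∈ S → All (_∈ S) (corners Δ)

    complete : ∀ {Δ u v} → EdgeOf Δ u v → Completion Δ u v
    complete {Δ} (u∈ , v∈ , u≢v) = by u∈ v∈ u≢v
      where
      open Triangle Δ
      by : ∀ {u v} → u ∈ corners Δ → v ∈ corners Δ → u ≢ v → Completion Δ u v
      by (here refl)                 (here refl)                 u≢v = contradiction refl u≢v
      by (there (here refl))         (there (here refl))         u≢v = contradiction refl u≢v
      by (there (there (here refl))) (there (there (here refl))) u≢v = contradiction refl u≢v
      by (here refl)                 (there (here refl))         _ =
        completion c ab ac bc λ p q r → p ∷ q ∷ r ∷ []
      by (here refl)                 (there (there (here refl))) _ =
        completion b ac ab (sym G bc) λ p q r → p ∷ r ∷ q ∷ []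
      by (there (here refl))         (here refl)                 _ =
        completion c (sym G ab) bc ac λ p q r → q ∷ p ∷ r ∷ []
      by (there (here refl))         (there (there (here refl))) _ =
        completion a bc (sym G ab) (sym G ac) λ p q r → r ∷ p ∷ q ∷ []
      by (there (there (here refl))) (here refl)                 _ =
        completion b (sym G ac) (sym G bc) ab λ p q r → q ∷ r ∷ p ∷ []
      by (there (there (here refl))) (there (here refl))         _ =
        completion a (sym G bc) (sym G ac) (sym G ab) λ p q r → r ∷ q ∷ p ∷ []

    Grown : List V → ℕ → Set
    Grown S k = ∃[ S′ ] (Linked S′ (suc k) × Advance S S′)

    -- The triangle on `ab` is undone because of `b`. Whether one or two of its corners are missing,
    -- one colour brings them all into `S`.
    grow-triangle : ∀ {S k a b} → Linked S k → TriangleEdge 𝒯 a b → a ∈ S → b ∉ S → Grown S k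
    grow-triangle {S} {a = a} {b} L ab a∈S b∉S with Δ , Δ∈𝒯 , edge ← find ab
      with completion t uv ut vt cover ← complete {Δ} edge
         | undoneΔ ← (λ d → b∉S (All.lookup d (proj₁ (proj₂ edge))))
      with t ∈? S
    ... | yes t∈S = b ∷ S , linked-vertex L a∈S b∉S uv ,
      advance there (triangle-item Δ∈𝒯) undoneΔ (cover (there a∈S) (here refl) (there t∈S))
    ... | no t∉S  = b ∷ t ∷ S , linked-triangle L a∈S b∉S t∉S uv ut vt ,
      advance (there ∘ there) (triangle-item Δ∈𝒯) undoneΔ
        (cover (there (there a∈S)) (here refl) (there (here refl)))

    grow : ∀ {S k w} → Linked S k → Frontier S w → Grown S k
    grow {S} {w = w} L (2≤w , w∉S , s , s∈S , sw) with any? touched?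
      where
      Touched : V → Set
      Touched z = z ∈ S × Σ[ on ∈ OnTriangle 𝒯 w ] In (to (w , on)) z

      touched? : ∀ z → Dec (Touched z)
      touched? z with onTriangle? 𝒯 w
      ... | no ¬on = no (¬on ∘ proj₁ ∘ proj₂)
      ... | yes on = z ∈? S ×-dec map′ (on ,_)
        (λ (on′ , onz , eq) → onz , trans eq (to-cong {w , on′} {w , on} ε)) (in? (to (w , on)) z)
    -- The component of `w` already meets `S` in `z`. A walk of triangle edges from `z` to `w`
    -- leaves `S` somewhere, and growth happens at that edge, possibly away from `w`.
    ... | yes (z , z∈S , on , onz , eq) with a , b , ab , a∈S , b∉S ← crossing (injective eq) z∈S w∉S =
      grow-triangle L ab a∈S b∉S
    ... | no ¬touched = w ∷ S , linked-vertex L s∈S w∉S sw ,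
      advance-fresh 2≤w w∉S (λ on (z , z∈S , inκ) → ¬touched (z , z∈S , on , inκ))

    Saturated : ℕ → Set
    Saturated N = ∃[ S ] ∃[ k ] (Linked S k × (∃[ s ] s ∈ S) × (∀ w → ¬ Frontier S w) × k ≤ N)

    -- Each growth spends one colour and lowers `undone` by at least one, so `k + undone S` never
    -- increases.
    saturate : ∀ fuel {S k s} → Linked S k → s ∈ S → undone S ≤ fuel → Saturated (k + undone S)
    saturate fuel {S} {k} L s∈S fuel≥ with any? (frontier? S)
    ... | no ¬f = S , k , L , (_ , s∈S) , (λ w f → ¬f (w , f)) , ℕ.m≤m+n k _
    ... | yes (_ , f) with S′ , L′ , adv ← grow L f with fuel | ℕ.≤-trans (undone-< adv) fuel≥
    ...   | suc fuel′ | s≤s fuel≥′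
      with S″ , k″ , L″ , nonempty , closed , k″≤ ← saturate fuel′ L′ (Advance.grows adv s∈S) fuel≥′ =
      S″ , k″ , L″ , nonempty , closed ,
      ℕ.≤-trans k″≤ (ℕ.≤-trans (ℕ.≤-reflexive (≡-sym (ℕ.+-suc k _))) (ℕ.+-monoʳ-≤ k (undone-< adv)))

    bounded-colouring : Connected G → ∃[ k ] (RainbowColourable (lineGraph G) k × k ≤ length 𝒯 + n₂′ G 𝒯 + m)
    bounded-colouring (_ , walks) with any? (λ v → 2 ℕ.≤? degree G v)
    ... | no low = 0 , (χ , λ i j → subst (RainbowPath χ i) (equal i j) (ε , [] ∷ [] , [])) , z≤n
      where
      equal = edges-equal walks (λ v 2≤v → low (v , 2≤v))
      χ : EdgeColouring (lineGraph G) 0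
      χ = record { colour     = λ {i} {j} (i≢j , _) → contradiction (equal i j) i≢j
                 ; colour-sym = λ {i} {j} (i≢j , _) _ → contradiction (equal i j) i≢j }
    ... | yes (v , 2≤v)
      with S , k , L , (s , s∈S) , closed , k≤ ← saturate _ (linked-start v) (here refl) ℕ.≤-refl =
      k , linked⇒colourable L (closed⇒meets closed s∈S (walks s)) ,
      ℕ.≤-trans k≤ (ℕ.≤-trans (undone-< first) (ℕ.≤-trans (length-filter _ items) (ℕ.≤-reflexive length-items)))
      where
      -- The single colour of `linked-start` is charged as well: `v` has degree at least 2, so it
      -- completes an item that was undone for the empty set.
      first : Advance [] (v ∷ [])
      first = advance-fresh 2≤v (λ ()) (λ _ ())

-- Sharpness

-- A path joining `u` and `v` has at least two edges, with distinct colours.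
nonadjacent⇒2≤ : ∀ {n k} {H : Graph n} {u v} → u ≢ v → ¬ Adj H u v → RainbowColourable H k → 2 ≤ k
nonadjacent⇒2≤ {u = u} {v} u≢v ¬uv (χ , rc) with rc u v
... | ε         , _ , _ = contradiction refl u≢v
... | e ◅ ε     , _ , _ = contradiction e ¬uv
... | _ ◅ _ ◅ _ , _ , u = ℕ.≤-trans (s≤s (s≤s z≤n)) (unique-length≤ u)

-- The triangle 012 with pendant edges 03 and 14.
bullEdges : List (Fin 5 × Fin 5)
bullEdges = (# 0 , # 1) ∷ (# 1 , # 2) ∷ (# 0 , # 2) ∷ (# 0 , # 3) ∷ (# 1 , # 4) ∷ []

bull : Graph 5
bull = record
  { Adj    = λ u v → (u , v) ∈ bullEdges ⊎ (v , u) ∈ bullEdges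
  ; adj?   = adjacent?
  ; sym    = Sum.swap
  ; irrefl = λ { {u} refl → from-yes (all? λ u → ¬? (adjacent? u u)) u }
  }
  where
  open DecMembership (≡-dec (Fin._≟_ {5}) (Fin._≟_ {5})) using () renaming (_∈?_ to _∈ₑ?_)
  adjacent? : ∀ u v → Dec ((u , v) ∈ bullEdges ⊎ (v , u) ∈ bullEdges)
  adjacent? u v = (u , v) ∈ₑ? bullEdges ⊎-dec (v , u) ∈ₑ? bullEdges

bull-connected : Connected bull
bull-connected = # 0 , λ u v → toCentre u ◅◅ fromCentre v
  where
  toCentre : ∀ u → Walk bull u (# 0)
  toCentre zero                          = ε
  toCentre (suc zero)                    = from-yes (adj? bull (# 1) (# 0)) ◅ ε
  toCentre (suc (suc zero))              = from-yes (adj? bull (# 2) (# 0)) ◅ ε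
  toCentre (suc (suc (suc zero)))        = from-yes (adj? bull (# 3) (# 0)) ◅ ε
  toCentre (suc (suc (suc (suc zero)))) =
    from-yes (adj? bull (# 4) (# 1)) ◅ from-yes (adj? bull (# 1) (# 0)) ◅ ε
  fromCentre : ∀ v → Walk bull (# 0) v
  fromCentre v = Star.reverse (λ {x} {y} → sym bull {x} {y}) (toCentre v)

bullTriangle : Triangle bull
bullTriangle = record
  { a = # 0 ; b = # 1 ; c = # 2
  ; ab = from-yes (adj? bull (# 0) (# 1))
  ; bc = from-yes (adj? bull (# 1) (# 2))
  ; ac = from-yes (adj? bull (# 0) (# 2))
  }

-- Two corners of a triangle are equal or joined by one of its edges.
one-component : ∀ {n} {G : Graph n} (Δ : Triangle G) → HasComponents (Δ ∷ []) 1
one-component Δ = record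
  { to        = λ _ → zero
  ; cong      = λ _ → refl
  ; bijective = (λ {x} {y} _ → joined x y) , λ { zero → (Triangle.a Δ , here (here refl)) , λ _ → refl }
  }
  where
  joined : ∀ x y → Setoid._≈_ (Components (Δ ∷ [])) x y
  joined (u , here u∈) (v , here v∈) with u Fin.≟ v
  ... | yes refl = ε
  ... | no  u≢v  = here (u∈ , v∈ , u≢v) ◅ ε

-- Positions 2 and 4 of edges bull are the pendant edges 03 and 14.
bull-lower : ∀ k → RainbowColourable (lineGraph bull) k → 2 ≤ k
bull-lower k = nonadjacent⇒2≤ {u = # 2} {v = # 4} (λ ()) (from-no (adj? (lineGraph bull) (# 2) (# 4)))

exact : ∀ {n} {H : Graph n} {r} → (∀ k → RainbowColourable H k → r ≤ k) →
        ∃[ k ] (RainbowColourable H k × k ≤ r) → IsRainbowConnectionNumber H r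
exact {H = H} lower (k , colourable , k≤r) =
  subst (RainbowColourable H) (ℕ.≤-antisym k≤r (lower k colourable)) colourable , lower

-- The upper bound evaluates to 1 + 0 + 1: one triangle, one component, and both vertices off the
-- triangle have degree 1.
bull-rc : IsRainbowConnectionNumber (lineGraph bull) 2
bull-rc = exact bull-lower
  (Growth.bounded-colouring bull (bullTriangle ∷ []) 1 (one-component bullTriangle) bull-connected)

theorem3p5 : (∀ {n : ℕ} (G : Graph n) → Connected G →
    (𝒯 : List (Triangle G)) → AllPairs EdgeDisjoint 𝒯 →
    (c : ℕ) → HasComponents 𝒯 c →
    ∃[ r ] (IsRainbowConnectionNumber (lineGraph G) r × r ≤ length 𝒯 + n₂′ G 𝒯 + c))
    ×
    (Σ[ n ∈ ℕ ] Σ[ G ∈ Graph n ] Σ[ 𝒯 ∈ List (Triangle G) ] Σ[ c ∈ ℕ ]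
    (Connected G × AllPairs EdgeDisjoint 𝒯 × HasComponents 𝒯 c ×
    Connected (lineGraph G) × IsRainbowConnectionNumber (lineGraph G) (length 𝒯 + n₂′ G 𝒯 + c)))
theorem3p5 = upper , 5 , bull , bullTriangle ∷ [] , 1 ,
  bull-connected , [] ∷ [] , one-component bullTriangle ,
  -- The rainbow paths, with colours forgotten, connect the line graph.
  (zero , λ i j → proj₁ (proj₂ (proj₁ bull-rc) i j)) , bull-rc
  where
  upper : ∀ {n : ℕ} (G : Graph n) → Connected G → (𝒯 : List (Triangle G)) → AllPairs EdgeDisjoint 𝒯 →
          (c : ℕ) → HasComponents 𝒯 c →
          ∃[ r ] (IsRainbowConnectionNumber (lineGraph G) r × r ≤ length 𝒯 + n₂′ G 𝒯 + c)
  upper G connected 𝒯 _ c components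
    with k , colourable , k≤ ← Growth.bounded-colouring G 𝒯 c components connected
    with r , rc , r≤k ← rainbowConnectionNumber colourable = r , rc , ℕ.≤-trans r≤k k≤
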